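{- Let $1 \le s < t$, let $M_0, M_1, \ldots, M_{t-1}$ be linear orders each equal to $\omega$ or $\omega^*$ which alternate (i.e. $M_{i+1} \neq M_i$), and let $m_i$ ($i<s$) and $n_j$ ($j<t$) be non-zero natural numbers. Let $A = M_0^{m_0} \cdot M_1^{m_1} \cdots M_{s-1}^{m_{s-1}}$ and $B = M_0^{n_0} \cdot M_1^{n_1} \cdots M_{t-1}^{n_{t-1}}$. Let $u$ be the smallest $i < s$ such that $m_i \neq n_i$, or $u = s$ if $m_i = n_i$ for all $i < s$. Then: (i) if $u = s$ or $u = s-1$, then $l(A,B) = 2(m_0 + m_1 + \cdots + m_{s-2}) + 1$ (the sum being empty, hence $l(A,B)=1$, when $s=1$); (ii) if $u = s-2$ and $m_{s-2} < n_{s-2}$, then $l(A,B) = 2(m_0 + \cdots + m_{s-3} + m_{s-2}) + 1$, and if $u = s-2$ and $n_{s-2} < m_{s-2}$, then $l(A,B) = 2(m_0 + \cdots + m_{s-3} + n_{s-2}) + 2$; (iii) if $u < s-2$, then $l(A,B) = 2(m_0 + m_1 + \cdots + m_{u-1} + \min(m_u, n_u)) + 2$.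
   Context: All orders are linear orders. $\omega^*$ is the reverse of $\omega$. For linear orders $X, Y$, $X \cdot Y$ denotes the anti-lexicographic product ("$Y$ copies of $X$"): pairs $(x,y)$, $x\in X$, $y \in Y$, compared first by $y$, then by $x$. $M^n$ denotes the product of $n$ copies of $M$. For $n \ge 1$, $X \equiv_n Y$ means player II has a winning strategy in the $n$-move Ehrenfeucht–Fraïssé game on $X$ and $Y$ (each move: I picks an element of either structure, II an element of the other; II wins if the correspondence between chosen elements is an order-isomorphism of the induced substructures). $X \equiv Y$ iff $X \equiv_n Y$ for all $n$. For $X \not\equiv Y$, $l(X,Y)$ is the non-zero natural number $n$ with $X \equiv_n Y$ and $X \not\equiv_{n+1} Y$. -}

module Defs where

open import Data.Nat using (ℕ; zero; suc; _+_; _<_; _≤_)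
open import Data.Bool using (Bool; true; false)
open import Data.Unit using (⊤; tt)
open import Data.Empty using (⊥)
open import Data.Product using (_×_; _,_; ∃)
open import Data.Sum using (_⊎_)
open import Data.List using (List; []; _∷_)
open import Data.List.Membership.Propositional using (_∈_)
open import Relation.Nullary using (¬_)
open import Relation.Binary.PropositionalEquality using (_≡_)
open import Function.Bundles using (_⇔_)

record LO : Set₁ where
  field
    Carrier : Set
    _≺_     : Carrier → Carrier → Set
open LO public

ω : LO
ω = record { Carrier = ℕ ; _≺_ = _<_ }

ω* : LO
ω* = record { Carrier = ℕ ; _≺_ = λ x y → y < x }

𝟙 : LO
𝟙 = record { Carrier = ⊤ ; _≺_ = λ _ _ → ⊥ }

-- X · Y : anti-lexicographic product, Y copies of X
-- (compare first by the Y-coordinate, then by the X-coordinate)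
_·_ : LO → LO → LO
X · Y = record
  { Carrier = Carrier X × Carrier Y
  ; _≺_ = λ { (x , y) (x' , y') →
        _≺_ Y y y' ⊎ (y ≡ y' × _≺_ X x x') } }

_^_ : LO → ℕ → LO
M ^ zero  = 𝟙
M ^ suc n = (M ^ n) · M

prod : ℕ → (ℕ → LO) → LO
prod zero    P = 𝟙
prod (suc k) P = prod k P · P k

ωor* : Bool → LO
ωor* true  = ω
ωor* false = ω*

sumTo : ℕ → (ℕ → ℕ) → ℕ
sumTo zero    f = 0
sumTo (suc k) f = sumTo k f + f k

PartialIso : (X Y : LO) → List (Carrier X × Carrier Y) → Set
PartialIso X Y ps =
  ∀ {a b a' b'} → (a , b) ∈ ps → (a' , b') ∈ ps →
    ((a ≡ a') ⇔ (b ≡ b')) × ((_≺_ X a a') ⇔ (_≺_ Y b b'))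

-- II has a winning strategy in the game with k remaining moves from
-- the position ps (list of pairs chosen so far).
Wins : (X Y : LO) → ℕ → List (Carrier X × Carrier Y) → Set
Wins X Y zero    ps = PartialIso X Y ps
Wins X Y (suc k) ps =
  (∀ (a : Carrier X) → ∃ λ (b : Carrier Y) → Wins X Y k ((a , b) ∷ ps)) ×
  (∀ (b : Carrier Y) → ∃ λ (a : Carrier X) → Wins X Y k ((a , b) ∷ ps))

-- X ≡ₙ Y : II wins the n-move Ehrenfeucht–Fraïssé game
_≡[_]_ : LO → ℕ → LO → Set
X ≡[ n ] Y = Wins X Y n []

IsL : LO → LO → ℕ → Set
IsL X Y n = 1 ≤ n × (X ≡[ n ] Y) × ¬ (X ≡[ suc n ] Y)

{-# OPTIONS --safe #-}
-- A product of powers of ω and ω* is a word in the letters ω and ω*, and a common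
-- first letter costs exactly two moves. If Spoiler wins on X, Y in k moves, he wins
-- on ω · X, ω · Y in k + 2 by playing limit points (0 , x): an answer that has an
-- immediate predecessor loses in two further moves. Conversely, if X and Y have no
-- least element, Duplicator copies ω-coordinates until two moves are left, and then
-- only needs to control which intervals between chosen points are empty.
-- Once the common prefix is stripped, either one word is a power of a single letter
-- and the other contains the opposite letter, so that an endpoint separates them in
-- two moves, or both orders are without endpoints and start with opposite letters,
-- so that the existence of immediate predecessors separates them in three.
module Submission where

open import Defs
open import Data.Nat using (ℕ; zero; suc; _+_; _*_; _∸_; _<_; _≤_; _⊓_; z≤n; s≤s)
open import Data.Nat.Properties
  using ( <-isStrictTotalOrder; <-cmp; <-irrefl; <-trans; ≤-trans; ≤-refl; ≤-reflexive; <⇒≤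
        ; <-≤-trans; ≤-<-trans; n<1+n; m<n⇒m<1+n; m≤m+n; m≤n+m; m∸n≤m; m∸n+n≡m; m≤n⇒∃[o]m+o≡n
        ; +-suc; +-comm; +-assoc; *-comm; m≤n⇒m⊓n≡m; m≥n⇒m⊓n≡n)
open import Data.Bool.Properties using (¬-not; not-involutive)
open import Data.Bool using (Bool; true; false; not)
open import Data.Unit using (⊤; tt)
open import Data.Empty using (⊥-elim)
open import Data.Product using (_×_; _,_; proj₁; proj₂; ∃; swap)
import Data.Product as Product
open import Data.Sum using (_⊎_; inj₁; inj₂)
open import Data.List using (List; []; _∷_; map; _++_; length; replicate)
open import Data.List.Membership.Propositional using (_∈_; find; lose)
open import Data.List.Membership.Propositional.Properties using (∈-map⁺; ∈-map⁻; ∈-++⁺ˡ; ∈-++⁺ʳ)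
open import Data.List.Properties using (++-assoc; ++-identityʳ; length-++; length-replicate)
open import Data.List.Relation.Unary.Any using (here; there; any?)
open import Function.Base using (_∘_; id; flip)
open import Function.Bundles using (_⇔_; mk⇔; Equivalence)
open import Relation.Nullary using (¬_; yes; no)
open import Relation.Binary.Definitions using (Tri; tri<; tri≈; tri>)
open import Relation.Binary.Structures using (IsStrictTotalOrder)
open import Relation.Binary.Structures.Biased using (isStrictTotalOrderᶜ)
import Relation.Binary.Construct.Flip.EqAndOrd as Flip
open import Relation.Binary.PropositionalEquality
  using (_≡_; _≢_; refl; sym; trans; cong; cong₂; subst; subst₂; isEquivalence)

-- Linear orders

op : LO → LO
op X = record { Carrier = Carrier X ; _≺_ = flip (_≺_ X) }

Strict : LO → Set
Strict X = IsStrictTotalOrder _≡_ (_≺_ X)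

op-strict : ∀ {X} → Strict X → Strict (op X)
op-strict = Flip.isStrictTotalOrder

NoMin HasMin : LO → Set
NoMin X = ∀ a → ∃ λ a' → _≺_ X a' a
HasMin X = ∃ λ a → ∀ a' → ¬ _≺_ X a' a

-- Room for a further point: when `a` is below `b`, the negation says that `b` covers `a`.
Gap : (X : LO) → Carrier X → Carrier X → Set
Gap X a b = ∃ λ c → _≺_ X a c × _≺_ X c b

·-strict : ∀ {X Y} → Strict X → Strict Y → Strict (X · Y)
·-strict {X} {Y} sX sY = isStrictTotalOrderᶜ record
  { isEquivalence = isEquivalence ; trans = tr ; compare = cmp }
  where
  module SX = IsStrictTotalOrder sX
  module SY = IsStrictTotalOrder sY
  tr : ∀ {p q r} → _≺_ (X · Y) p q → _≺_ (X · Y) q r → _≺_ (X · Y) p r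
  tr (inj₁ k) (inj₁ l) = inj₁ (SY.trans k l)
  tr (inj₁ k) (inj₂ (refl , _)) = inj₁ k
  tr (inj₂ (refl , _)) (inj₁ l) = inj₁ l
  tr (inj₂ (refl , k)) (inj₂ (refl , l)) = inj₂ (refl , SX.trans k l)
  cmp : ∀ p q → Tri (_≺_ (X · Y) p q) (p ≡ q) (_≺_ (X · Y) q p)
  cmp (x , y) (x' , y') with SY.compare y y'
  ... | tri< l ¬e ¬g = tri< (inj₁ l) (¬e ∘ cong proj₂)
        λ { (inj₁ g) → ¬g g ; (inj₂ (e , _)) → ¬e (sym e) }
  ... | tri> ¬l ¬e g = tri> (λ { (inj₁ l) → ¬l l ; (inj₂ (e , _)) → ¬e e })
        (¬e ∘ cong proj₂) (inj₁ g)
  ... | tri≈ ¬l refl ¬g with SX.compare x x'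
  ...   | tri< l ¬e ¬g' = tri< (inj₂ (refl , l)) (¬e ∘ cong proj₁)
          λ { (inj₁ g) → ¬g g ; (inj₂ (_ , g)) → ¬g' g }
  ...   | tri≈ ¬l' refl ¬g' = tri≈ (λ { (inj₁ l) → ¬l l ; (inj₂ (_ , l)) → ¬l' l })
          refl (λ { (inj₁ g) → ¬g g ; (inj₂ (_ , g)) → ¬g' g })
  ...   | tri> ¬l' ¬e g = tri> (λ { (inj₁ l) → ¬l l ; (inj₂ (_ , l)) → ¬l' l })
          (¬e ∘ cong proj₁) (inj₂ (refl , g))

𝟙-strict : Strict 𝟙
𝟙-strict = isStrictTotalOrderᶜ record
  { isEquivalence = isEquivalence ; trans = λ () ; compare = λ _ _ → tri≈ id refl id }

ωor*-strict : ∀ c → Strict (ωor* c)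
ωor*-strict true = <-isStrictTotalOrder
ωor*-strict false = Flip.isStrictTotalOrder <-isStrictTotalOrder

infix 4 _≅_
record _≅_ (X Y : LO) : Set where
  field
    to : Carrier X → Carrier Y
    from : Carrier Y → Carrier X
    to∘from : ∀ b → to (from b) ≡ b
    from∘to : ∀ a → from (to a) ≡ a
    mono : ∀ {a a'} → _≺_ X a a' → _≺_ Y (to a) (to a')
    cancel : ∀ {a a'} → _≺_ Y (to a) (to a') → _≺_ X a a'
open _≅_

injective : ∀ {X Y} (f : X ≅ Y) {a a'} → to f a ≡ to f a' → a ≡ a'
injective f {a} {a'} e = trans (sym (from∘to f a)) (trans (cong (from f) e) (from∘to f a'))

≅-refl : ∀ {X} → X ≅ X
≅-refl = record
  { to = id ; from = id ; to∘from = λ _ → refl ; from∘to = λ _ → refl ; mono = id ; cancel = id }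

≅-sym : ∀ {X Y} → X ≅ Y → Y ≅ X
≅-sym {X} {Y} f = record
  { to = from f ; from = to f ; to∘from = from∘to f ; from∘to = to∘from f
  ; mono = λ {b} {b'} l → cancel f (subst₂ (_≺_ Y) (sym (to∘from f b)) (sym (to∘from f b')) l)
  ; cancel = λ {b} {b'} l → subst₂ (_≺_ Y) (to∘from f b) (to∘from f b') (mono f l) }

≅-trans : ∀ {X Y Z} → X ≅ Y → Y ≅ Z → X ≅ Z
≅-trans f g = record
  { to = to g ∘ to f ; from = from f ∘ from g
  ; to∘from = λ c → trans (cong (to g) (to∘from f (from g c))) (to∘from g c)
  ; from∘to = λ a → trans (cong (from f) (from∘to g (to f a))) (from∘to f a)
  ; mono = mono g ∘ mono f ; cancel = cancel f ∘ cancel g }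

·-cong : ∀ {X X' Y Y'} → X ≅ X' → Y ≅ Y' → X · Y ≅ X' · Y'
·-cong f g = record
  { to = Product.map (to f) (to g) ; from = Product.map (from f) (from g)
  ; to∘from = λ (a , b) → cong₂ _,_ (to∘from f a) (to∘from g b)
  ; from∘to = λ (a , b) → cong₂ _,_ (from∘to f a) (from∘to g b)
  ; mono = λ { (inj₁ l) → inj₁ (mono g l) ; (inj₂ (refl , l)) → inj₂ (refl , mono f l) }
  ; cancel = λ { (inj₁ l) → inj₁ (cancel g l)
               ; (inj₂ (e , l)) → inj₂ (injective g e , cancel f l) } }

·-assoc : ∀ {X Y Z} → (X · Y) · Z ≅ X · (Y · Z)
·-assoc = record
  { to = λ ((x , y) , z) → x , y , z ; from = λ (x , y , z) → (x , y) , z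
  ; to∘from = λ _ → refl ; from∘to = λ _ → refl
  ; mono = λ { (inj₁ l) → inj₁ (inj₁ l) ; (inj₂ (refl , inj₁ l)) → inj₁ (inj₂ (refl , l))
             ; (inj₂ (refl , inj₂ (refl , l))) → inj₂ (refl , l) }
  ; cancel = λ { (inj₁ (inj₁ l)) → inj₁ l ; (inj₁ (inj₂ (refl , l))) → inj₂ (refl , inj₁ l)
               ; (inj₂ (refl , l)) → inj₂ (refl , inj₂ (refl , l)) } }

𝟙·X≅X : ∀ {X} → 𝟙 · X ≅ X
𝟙·X≅X = record
  { to = proj₂ ; from = tt ,_ ; to∘from = λ _ → refl ; from∘to = λ _ → refl
  ; mono = λ { (inj₁ l) → l ; (inj₂ (_ , ())) } ; cancel = inj₁ }

X·𝟙≅X : ∀ {X} → X · 𝟙 ≅ X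
X·𝟙≅X = record
  { to = proj₁ ; from = _, tt ; to∘from = λ _ → refl ; from∘to = λ _ → refl
  ; mono = λ { (inj₁ ()) ; (inj₂ (_ , l)) → l } ; cancel = λ l → inj₂ (refl , l) }

-- Carries every result about `ω · X` over to `ω* · X`: reverse `X`, multiply by `ω`, reverse back.
op-ω·op≅ω*· : ∀ {X} → op (ω · op X) ≅ ω* · X
op-ω·op≅ω*· = record
  { to = id ; from = id ; to∘from = λ _ → refl ; from∘to = λ _ → refl
  ; mono = λ { (inj₁ l) → inj₁ l ; (inj₂ (e , l)) → inj₂ (sym e , l) }
  ; cancel = λ { (inj₁ l) → inj₁ l ; (inj₂ (e , l)) → inj₂ (sym e , l) } }

-- Games

Wins-op : ∀ {X Y} k {ps} → Wins X Y k ps → Wins (op X) (op Y) k ps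
Wins-op zero w p q = proj₁ (w p q) , proj₂ (w q p)
Wins-op (suc k) (f , g) = (λ a → Product.map₂ (Wins-op k) (f a)) , (λ b → Product.map₂ (Wins-op k) (g b))

Wins-swap : ∀ {X Y} k {ps} → Wins X Y k ps → Wins Y X k (map swap ps)
Wins-swap zero w p q with ∈-map⁻ swap p | ∈-map⁻ swap q
... | _ , p' , refl | _ , q' , refl =
  let e , l = w p' q' in mk⇔ (E.from e) (E.to e) , mk⇔ (E.from l) (E.to l)
  where module E = Equivalence
Wins-swap (suc k) (f , g) = (λ b → Product.map₂ (Wins-swap k) (g b)) , (λ a → Product.map₂ (Wins-swap k) (f a))

Wins-≅ : ∀ {X X' Y Y'} (f : X ≅ X') (g : Y ≅ Y') k {ps} →
         Wins X Y k ps → Wins X' Y' k (map (Product.map (to f) (to g)) ps)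
Wins-≅ f g zero w p q with ∈-map⁻ _ p | ∈-map⁻ _ q
... | _ , p' , refl | _ , q' , refl = let e , l = w p' q' in
    mk⇔ (cong (to g) ∘ E.to e ∘ injective f) (cong (to f) ∘ E.from e ∘ injective g)
  , mk⇔ (mono g ∘ E.to l ∘ cancel f) (mono f ∘ E.from l ∘ cancel g)
  where
  module E = Equivalence
Wins-≅ {X' = X'} {Y' = Y'} f g (suc k) {ps} (w , v) =
    (λ a → let b , x = w (from f a) in
       to g b , subst (λ a → Wins X' Y' k ((a , to g b) ∷ _)) (to∘from f a) (Wins-≅ f g k x))
  , (λ b → let a , x = v (from g b) in
       to f a , subst (λ b → Wins X' Y' k ((to f a , b) ∷ _)) (to∘from g b) (Wins-≅ f g k x))

-- Chosen pairs are never withdrawn, so the remaining moves can be wasted on one point; `a` is that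
-- point.
Wins⇒PartialIso : ∀ {X Y} → Carrier X → ∀ k {ps} → Wins X Y k ps → PartialIso X Y ps
Wins⇒PartialIso a zero w = w
Wins⇒PartialIso a (suc k) (f , _) p q = Wins⇒PartialIso a k (proj₂ (f a)) (there p) (there q)

-- Spoiler plays b', then an element of the gap left by the answer.
no-cover : ∀ {X Y a b b'} k {ps} → (∀ a' → _≺_ X a' a → Gap X a' a) →
           _≺_ Y b' b → ¬ Gap Y b' b → ¬ Wins X Y (2 + k) ((a , b) ∷ ps)
no-cover {X} {Y} {a} {b} {b'} k gap b'≺b ¬gap (_ , back) =
  ¬gap (c' , E.to (proj₂ (iso' (there (here refl)) (here refl))) a'≺c
           , E.to (proj₂ (iso' (here refl) (there (there (here refl))))) c≺a)
  where
  module E = Equivalence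
  a' = proj₁ (back b')
  w = proj₂ (back b')
  iso = Wins⇒PartialIso {X} {Y} a (suc k) w
  split = gap a' (E.from (proj₂ (iso (here refl) (there (here refl)))) b'≺b)
  c = proj₁ split
  a'≺c = proj₁ (proj₂ split)
  c≺a = proj₂ (proj₂ split)
  c' = proj₁ (proj₁ w c)
  iso' = Wins⇒PartialIso {X} {Y} a k (proj₂ (proj₁ w c))

-- Spoiler plays the least element, then something below Duplicator's answer.
≢₂-HasMin-NoMin : ∀ {X Y} → HasMin X → NoMin Y → ¬ (X ≡[ 2 ] Y)
≢₂-HasMin-NoMin (a , min) noMin (f , _) =
  let b , (_ , g) = f a
      b' , b'≺b = noMin b
      a' , iso = g b'
  in min a' (Equivalence.from (proj₂ (iso (here refl) (there (here refl)))) b'≺b)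

IsL-sym : ∀ {X Y n} → IsL X Y n → IsL Y X n
IsL-sym {n = n} (1≤n , e , ¬e) = 1≤n , Wins-swap n e , ¬e ∘ Wins-swap (suc n)

IsL-≅ : ∀ {X X' Y Y' n} → X ≅ X' → Y ≅ Y' → IsL X Y n → IsL X' Y' n
IsL-≅ {n = n} f g (1≤n , e , ¬e) =
  1≤n , Wins-≅ f g n e , ¬e ∘ Wins-≅ (≅-sym f) (≅-sym g) (suc n)

-- Agreement of positions and Duplicator's answers

-- S records what the intervals between the two pairs have in common.
data Agree (X Y : LO) (S : (p q : Carrier X × Carrier Y) → Set)
           (p q : Carrier X × Carrier Y) : Set where
  lt : _≺_ X (proj₁ p) (proj₁ q) → _≺_ Y (proj₂ p) (proj₂ q) → S p q → Agree X Y S p q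
  eq : proj₁ p ≡ proj₁ q → proj₂ p ≡ proj₂ q → Agree X Y S p q
  gt : _≺_ X (proj₁ q) (proj₁ p) → _≺_ Y (proj₂ q) (proj₂ p) → S q p → Agree X Y S p q

Any-interval : (X Y : LO) (p q : Carrier X × Carrier Y) → Set
Any-interval X Y p q = ⊤

-- What Duplicator has to maintain when one move is left: a point can be inserted between two chosen
-- ones on both sides or on neither.
SameGap : (X Y : LO) (p q : Carrier X × Carrier Y) → Set
SameGap X Y (a , b) (a' , b') = Gap X a a' ⇔ Gap Y b b'

SameGap-swap : ∀ X Y {p q} → SameGap X Y p q → SameGap Y X (swap p) (swap q)
SameGap-swap _ _ g = mk⇔ (Equivalence.from g) (Equivalence.to g)

module _ {X Y : LO} where

  Agree-sym : ∀ {S p q} → Agree X Y S p q → Agree X Y S q p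
  Agree-sym (lt x y s) = gt x y s
  Agree-sym (eq x y) = eq (sym x) (sym y)
  Agree-sym (gt x y s) = lt x y s

  Agree-forget : ∀ {S p q} → Agree X Y S p q → Agree X Y (Any-interval X Y) p q
  Agree-forget (lt x y s) = lt x y tt
  Agree-forget (eq x y) = eq x y
  Agree-forget (gt x y s) = gt x y tt

  Agree-op : ∀ {S p q} → Agree X Y S p q → Agree (op X) (op Y) (Any-interval (op X) (op Y)) p q
  Agree-op (lt x y _) = gt x y tt
  Agree-op (eq x y) = eq x y
  Agree-op (gt x y _) = lt x y tt

  Agree-swap : ∀ {S S' p q} → (∀ {p q} → S p q → S' (swap p) (swap q)) →
               Agree X Y S p q → Agree Y X S' (swap p) (swap q)
  Agree-swap h (lt x y s) = lt y x (h s)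
  Agree-swap h (eq x y) = eq y x
  Agree-swap h (gt x y s) = gt y x (h s)

  Agree-subst : ∀ {S p q a} → proj₁ p ≡ a → Agree X Y S p q → Agree X Y S (a , proj₂ p) q
  Agree-subst refl x = x

  Agree⇒iso : ∀ {S p q} → Strict X → Strict Y → Agree X Y S p q →
              ((proj₁ p ≡ proj₁ q) ⇔ (proj₂ p ≡ proj₂ q)) ×
              (_≺_ X (proj₁ p) (proj₁ q) ⇔ _≺_ Y (proj₂ p) (proj₂ q))
  Agree⇒iso sX sY = λ where
      (lt x y _) → mk⇔ (λ e → ⊥-elim (SX.irrefl e x)) (λ e → ⊥-elim (SY.irrefl e y))
                 , mk⇔ (λ _ → y) (λ _ → x)
      (eq x y) → mk⇔ (λ _ → y) (λ _ → x)
               , mk⇔ (⊥-elim ∘ SX.irrefl x) (⊥-elim ∘ SY.irrefl y)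
      (gt x y _) → mk⇔ (λ e → ⊥-elim (SX.irrefl (sym e) x)) (λ e → ⊥-elim (SY.irrefl (sym e) y))
                 , mk⇔ (⊥-elim ∘ SX.asym x) (⊥-elim ∘ SY.asym y)
    where
    module SX = IsStrictTotalOrder sX
    module SY = IsStrictTotalOrder sY

  iso⇒Agree : ∀ {a b a' b'} → Strict X →
              ((a ≡ a') ⇔ (b ≡ b')) × ((_≺_ X a a') ⇔ (_≺_ Y b b')) →
              ((_≺_ X a' a) ⇔ (_≺_ Y b' b)) → Agree X Y (Any-interval X Y) (a , b) (a' , b')
  iso⇒Agree {a} {b} {a'} {b'} sX (e , l) g with IsStrictTotalOrder.compare sX a a'
  ... | tri< x _ _ = lt x (Equivalence.to l x) tt
  ... | tri≈ _ x _ = eq x (Equivalence.to e x)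
  ... | tri> _ _ x = gt x (Equivalence.to g x) tt

-- Reading the pairs through `f` allows histories that carry more data, such as the ω-coordinate of
-- each move.
Agreeing : (X Y : LO) (S : (p q : Carrier X × Carrier Y) → Set) {P : Set} →
           (P → Carrier X × Carrier Y) → List P → Set
Agreeing X Y S f ps = ∀ {p q} → p ∈ ps → q ∈ ps → Agree X Y S (f p) (f q)

Agreeing-∷ : ∀ {X Y S ps r} → Agreeing X Y S id ps →
             (∀ {q} → q ∈ ps → Agree X Y S r q) → Agreeing X Y S id (r ∷ ps)
Agreeing-∷ ag new (here refl) (here refl) = eq refl refl
Agreeing-∷ ag new (here refl) (there q) = new q
Agreeing-∷ ag new (there p) (here refl) = Agree-sym (new p)
Agreeing-∷ ag new (there p) (there q) = ag p q

∈-map-elim : ∀ {P Q : Set} {f : P → Q} {ps} (T : Q → Set) →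
             (∀ {p} → p ∈ ps → T (f p)) → ∀ {q} → q ∈ map f ps → T q
∈-map-elim {f = f} T all q∈ with ∈-map⁻ f q∈
... | _ , p∈ , refl = all p∈

Agreeing-map : ∀ {X Y S P} {f : P → Carrier X × Carrier Y} {ps} →
               Agreeing X Y S f ps → Agreeing X Y S id (map f ps)
Agreeing-map {f = f} ag p q with ∈-map⁻ f p | ∈-map⁻ f q
... | _ , p' , refl | _ , q' , refl = ag p' q'

Agreeing⇒PartialIso : ∀ {X Y S ps} → Strict X → Strict Y → Agreeing X Y S id ps → PartialIso X Y ps
Agreeing⇒PartialIso sX sY ag p q = Agree⇒iso sX sY (ag p q)

-- Finds the nearest chosen point below `a`. Its maximality is expressed on the `Y` side, where the
-- answer must be placed; agreement transfers the comparison. On reversed orders it finds the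
-- nearest chosen point above.
predecessor : ∀ {X Y S P} {f : P → Carrier X × Carrier Y} → Strict X → Strict Y →
  ∀ ps → Agreeing X Y S f ps → ∀ a →
  (∀ {q} → q ∈ ps → ¬ _≺_ X (proj₁ (f q)) a) ⊎
  ∃ λ p → p ∈ ps × _≺_ X (proj₁ (f p)) a ×
    (∀ {q} → q ∈ ps → _≺_ X (proj₁ (f q)) a →
      proj₂ (f q) ≡ proj₂ (f p) ⊎ _≺_ Y (proj₂ (f q)) (proj₂ (f p)))
predecessor sX sY [] ag a = inj₁ λ ()
predecessor {X} {Y} {f = f} sX sY (r ∷ ps) ag a
  with IsStrictTotalOrder.compare sX (proj₁ (f r)) a | predecessor sX sY ps (λ p q → ag (there p) (there q)) a
... | tri≈ ¬r _ _ | inj₁ none = inj₁ λ { (here refl) → ¬r ; (there q) → none q }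
... | tri> ¬r _ _ | inj₁ none = inj₁ λ { (here refl) → ¬r ; (there q) → none q }
... | tri≈ ¬r _ _ | inj₂ (p , p∈ , p≺ , max) =
  inj₂ (p , there p∈ , p≺ , λ { (here refl) → ⊥-elim ∘ ¬r ; (there q) → max q })
... | tri> ¬r _ _ | inj₂ (p , p∈ , p≺ , max) =
  inj₂ (p , there p∈ , p≺ , λ { (here refl) → ⊥-elim ∘ ¬r ; (there q) → max q })
... | tri< r≺ _ _ | inj₁ none =
  inj₂ (r , here refl , r≺ , λ { (here refl) _ → inj₁ refl ; (there q) → ⊥-elim ∘ none q })
... | tri< r≺ _ _ | inj₂ (p , p∈ , p≺ , max) with ag (here refl) (there p∈)
...   | lt _ y _ = inj₂ (p , there p∈ , p≺ , λ { (here refl) _ → inj₂ y ; (there q) → max q })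
...   | eq _ y = inj₂ (p , there p∈ , p≺ , λ { (here refl) _ → inj₁ y ; (there q) → max q })
...   | gt _ y _ = inj₂ (r , here refl , r≺ , λ where
          (here refl) _ → inj₁ refl
          (there q) q≺ → inj₂ (below (max q q≺)))
  where
  below : ∀ {b} → b ≡ proj₂ (f p) ⊎ _≺_ Y b (proj₂ (f p)) → _≺_ Y b (proj₂ (f r))
  below (inj₁ refl) = y
  below (inj₂ l) = IsStrictTotalOrder.trans sY l y

locate : ∀ {X Y : LO} {P : Set} {f : P → Carrier X × Carrier Y} → Strict X → ∀ ps a →
  (∃ λ p → p ∈ ps × proj₁ (f p) ≡ a) ⊎ (∀ {q} → q ∈ ps → a ≢ proj₁ (f q))
locate {f = f} sX ps a with any? {P = λ p → proj₁ (f p) ≡ a} (λ p → IsStrictTotalOrder._≟_ sX (proj₁ (f p)) a) ps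
... | yes x = inj₁ (find x)
... | no ¬x = inj₂ λ q e → ¬x (lose q (sym e))

module _ {X Y : LO} (sX : Strict X) (sY : Strict Y)
         {P : Set} {f : P → Carrier X × Carrier Y} {ps : List P} where

  private
    module SX = IsStrictTotalOrder sX
    module SY = IsStrictTotalOrder sY

  fresh-agree : ∀ {a b} → (∀ {q} → q ∈ ps → a ≢ proj₁ (f q)) →
    (∀ {q} → q ∈ ps → _≺_ X (proj₁ (f q)) a → _≺_ Y (proj₂ (f q)) b) →
    (∀ {q} → q ∈ ps → _≺_ X a (proj₁ (f q)) → _≺_ Y b (proj₂ (f q))) →
    ∀ {q} → q ∈ ps → Agree X Y (Any-interval X Y) (a , b) (f q)
  fresh-agree {a} fresh below above {q} q∈ with SX.compare a (proj₁ (f q))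
  ... | tri< l _ _ = lt l (above q∈ l) tt
  ... | tri≈ _ e _ = ⊥-elim (fresh q∈ e)
  ... | tri> _ _ l = gt l (below q∈ l) tt

  monotone : ∀ {S} → Agreeing X Y S f ps → ∀ {p q} → p ∈ ps → q ∈ ps →
    _≺_ X (proj₁ (f p)) (proj₁ (f q)) → _≺_ Y (proj₂ (f p)) (proj₂ (f q)) × S (f p) (f q)
  monotone ag p q l with ag p q
  ... | lt _ y s = y , s
  ... | eq e _ = ⊥-elim (SX.irrefl e l)
  ... | gt x _ _ = ⊥-elim (SX.asym l x)

  private
    ≺-≼ : ∀ {b c d} → _≺_ Y b c → d ≡ c ⊎ _≺_ Y c d → _≺_ Y b d
    ≺-≼ l (inj₁ refl) = l
    ≺-≼ l (inj₂ m) = SY.trans l m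
    ≼-≺ : ∀ {b c d} → d ≡ c ⊎ _≺_ Y d c → _≺_ Y c b → _≺_ Y d b
    ≼-≺ (inj₁ refl) l = l
    ≼-≺ (inj₂ m) l = SY.trans m l

  answer-below : NoMin Y → Carrier Y → ∀ {S} → Agreeing X Y S f ps →
    ∀ {a} → (∀ {q} → q ∈ ps → a ≢ proj₁ (f q)) → (∀ {q} → q ∈ ps → ¬ _≺_ X (proj₁ (f q)) a) →
    ∃ λ b → ∀ {q} → q ∈ ps → Agree X Y (Any-interval X Y) (a , b) (f q)
  answer-below noMin b₀ ag {a} fresh none
    with predecessor (op-strict sX) (op-strict sY) ps (λ p q → Agree-op (ag p q)) a
  ... | inj₁ none' =
    -- Nothing chosen is below, above or equal to `a`, so the position is empty and any answer will
    -- do.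
    b₀ , fresh-agree fresh (λ q l → ⊥-elim (none q l)) (λ q l → ⊥-elim (none' q l))
  ... | inj₂ (p , p∈ , a≺p , min) =
    let b , b≺ = noMin (proj₂ (f p)) in
    b , fresh-agree fresh (λ q l → ⊥-elim (none q l)) (λ q l → ≺-≼ b≺ (min q l))

  -- A new point lying beyond all chosen ones is answered by endlessness of `Y`, one between two
  -- neighbours by `SameGap`.
  answer₁ : NoMin Y → NoMin (op Y) → Carrier Y → Agreeing X Y (SameGap X Y) f ps →
    ∀ a → ∃ λ b → ∀ {q} → q ∈ ps → Agree X Y (Any-interval X Y) (a , b) (f q)
  answer₁ noMin noMax b₀ ag a with locate {X} {Y} {f = f} sX ps a
  ... | inj₁ (p , p∈ , e) = proj₂ (f p) , λ q∈ → Agree-forget (Agree-subst e (ag p∈ q∈))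
  ... | inj₂ fresh with predecessor sX sY ps ag a
  ...   | inj₁ none = answer-below noMin b₀ ag fresh none
  ...   | inj₂ (p , p∈ , p≺a , max)
    with predecessor (op-strict sX) (op-strict sY) ps (λ p q → Agree-op (ag p q)) a
  ...     | inj₁ none =
    let b , ≺b = noMax (proj₂ (f p)) in
    b , fresh-agree fresh (λ q l → ≼-≺ (max q l) ≺b) (λ q l → ⊥-elim (none q l))
  ...     | inj₂ (r , r∈ , a≺r , min) =
    -- `a` itself witnesses that the interval between its neighbours is nonempty, hence so is the
    -- interval between their partners.
    let b , ≺b , b≺ = Equivalence.to (proj₂ (monotone ag p∈ r∈ (SX.trans p≺a a≺r))) (a , p≺a , a≺r) in
    b , fresh-agree fresh (λ q l → ≼-≺ (max q l) ≺b) (λ q l → ≺-≼ b≺ (min q l))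

module _ {X Y : LO} (sX : Strict X) (sY : Strict Y)
         (noMinX : NoMin X) (noMaxX : NoMin (op X)) (noMinY : NoMin Y) (noMaxY : NoMin (op Y))
         (a₀ : Carrier X) (b₀ : Carrier Y) where

  wins₁ : ∀ {ps} → Agreeing X Y (SameGap X Y) id ps → Wins X Y 1 ps
  wins₁ {ps} ag =
      (λ a → let b , new = answer₁ sX sY noMinY noMaxY b₀ ag a in b , extend new)
    , (λ b → let a , new = answer₁ sY sX noMinX noMaxX a₀ swapped b in
         a , extend (λ q → Agree-swap _ (new q)))
    where
    swapped : Agreeing Y X (SameGap Y X) swap ps
    swapped p q = Agree-swap (λ {p} {q} → SameGap-swap X Y {p} {q}) (ag p q)
    extend : ∀ {r} → (∀ {q} → q ∈ ps → Agree X Y (Any-interval X Y) r q) →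
             PartialIso X Y (r ∷ ps)
    extend new = Agreeing⇒PartialIso sX sY (Agreeing-∷ (λ p q → Agree-forget (ag p q)) new)

  -- A single pair bounds no interval, so any first answer leaves a position to which `wins₁`
  -- applies.
  ≡₂-endless : X ≡[ 2 ] Y
  ≡₂-endless = (λ a → b₀ , wins₁ (Agreeing-∷ (λ ()) λ ()))
             , (λ b → a₀ , wins₁ (Agreeing-∷ (λ ()) λ ()))

-- Multiplying by ω

-- A copy of `ω` has no last element, so the left end can be increased within its own fibre.
Gap-fibres : ∀ {X x x' n n'} → _≺_ X x x' → Gap (ω · X) (n , x) (n' , x')
Gap-fibres {x = x} {n = n} l = (suc n , x) , inj₂ (refl , n<1+n n) , inj₁ l

-- A point between two points of one fibre stays in that fibre, so only the ω-coordinates matter and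
-- the fibre can be exchanged.
Gap-fibre : ∀ {X Y x n n'} → Strict X → (y : Carrier Y) →
            Gap (ω · X) (n , x) (n' , x) → Gap (ω · Y) (n , y) (n' , y)
Gap-fibre sX y (_ , inj₁ l , inj₁ m) = ⊥-elim (IsStrictTotalOrder.asym sX l m)
Gap-fibre sX y (_ , inj₁ l , inj₂ (refl , _)) = ⊥-elim (IsStrictTotalOrder.irrefl sX refl l)
Gap-fibre sX y (_ , inj₂ (refl , _) , inj₁ m) = ⊥-elim (IsStrictTotalOrder.irrefl sX refl m)
Gap-fibre sX y ((l , _) , inj₂ (_ , n<l) , inj₂ (_ , l<n')) =
  (l , y) , inj₂ (refl , n<l) , inj₂ (refl , l<n')

level : ∀ {A B : Set} → ℕ × A × B → (ℕ × A) × (ℕ × B)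
level (n , a , b) = (n , a) , (n , b)

above-all : ∀ {P : Set} (h : P → ℕ) ps → ∃ λ N → ∀ {p} → p ∈ ps → h p < N
above-all h [] = 0 , λ ()
above-all h (p ∷ ps) = let N , below = above-all h ps in
  suc (h p) + N , λ { (here refl) → s≤s (m≤m+n _ _) ; (there q) → ≤-trans (below q) (m≤n+m _ _) }

module _ {X Y : LO} (sX : Strict X) (sY : Strict Y) where

  Agree-fibres : ∀ {n x m y n' x' m' y'} → _≺_ X x x' → _≺_ Y y y' →
    Agree (ω · X) (ω · Y) (SameGap (ω · X) (ω · Y)) ((n , x) , (m , y)) ((n' , x') , (m' , y'))
  Agree-fibres k l =
    lt (inj₁ k) (inj₁ l) (mk⇔ (λ _ → Gap-fibres {Y} l) (λ _ → Gap-fibres {X} k))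

  -- Multiplication by `ω` turns agreement about order into agreement about gaps: intervals across
  -- fibres are never empty, and those inside a fibre depend only on the copied coordinates.
  Agree-ω : ∀ {S n n' p q} → Agree X Y S p q →
    Agree (ω · X) (ω · Y) (SameGap (ω · X) (ω · Y)) (level (n , p)) (level (n' , q))
  Agree-ω (lt k l _) = Agree-fibres k l
  Agree-ω (gt k l _) = Agree-sym (Agree-fibres k l)
  Agree-ω {n = n} {n'} {a , b} (eq refl refl) with <-cmp n n'
  ... | tri< l _ _ = lt (inj₂ (refl , l)) (inj₂ (refl , l))
                        (mk⇔ (Gap-fibre {X} {Y} sX b) (Gap-fibre {Y} {X} sY a))
  ... | tri≈ _ refl _ = eq refl refl
  ... | tri> _ _ l = gt (inj₂ (refl , l)) (inj₂ (refl , l))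
                        (mk⇔ (Gap-fibre {X} {Y} sX b) (Gap-fibre {Y} {X} sY a))

  -- A fresh fibre x is answered far up in the fibre of the predecessor of x
  -- among the fibres chosen so far, or below all of them.
  answer₂ : NoMin Y → Carrier Y → ∀ {P S} {f : P → ℕ × Carrier X × Carrier Y} {ps} →
    Agreeing X Y S (proj₂ ∘ f) ps → ∀ a → ∃ λ b → ∀ {q} → q ∈ ps →
    Agree (ω · X) (ω · Y) (SameGap (ω · X) (ω · Y)) (a , b) (level (f q))
  answer₂ noMin b₀ {f = f} {ps} ag (n , x) with locate {X} {Y} {f = proj₂ ∘ f} sX ps x
  ... | inj₁ (p , p∈ , e) = (n , proj₂ (proj₂ (f p))) , λ q∈ → Agree-ω (Agree-subst e (ag p∈ q∈))
  ... | inj₂ fresh with predecessor sX sY ps ag x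
  ...   | inj₁ none = let b , new = answer-below sX sY noMin b₀ ag fresh none in
          (n , b) , λ q∈ → Agree-ω (new q∈)
  ...   | inj₂ (p , p∈ , p≺x , max) =
    -- `N` exceeds every coordinate used so far by at least two. If a chosen point has its partner
    -- in the fibre of `y`, there is then room between that partner and the answer, just as between
    -- the two distinct fibres of `X`.
    let N , below = above-all (suc ∘ proj₁ ∘ f) ps in (N , y) , λ q∈ → new N q∈ (below q∈)
    where
    y : Carrier Y
    y = proj₂ (proj₂ (f p))
    new : ∀ N {q} → q ∈ ps → suc (proj₁ (f q)) < N →
      Agree (ω · X) (ω · Y) (SameGap (ω · X) (ω · Y)) ((n , x) , (N , y)) (level (f q))
    new N {q} q∈ h<N with IsStrictTotalOrder.compare sX x (proj₁ (proj₂ (f q)))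
    ... | tri< l _ _ =
      Agree-fibres l (proj₁ (monotone sX sY ag p∈ q∈ (IsStrictTotalOrder.trans sX p≺x l)))
    ... | tri≈ _ e _ = ⊥-elim (fresh q∈ e)
    ... | tri> _ _ l with max q∈ l
    ...   | inj₂ m = Agree-sym (Agree-fibres l m)
    ...   | inj₁ e = gt (inj₁ l) (inj₂ (e , <-trans (n<1+n _) h<N)) (mk⇔
              (λ _ → (suc (proj₁ (f q)) , proj₂ (proj₂ (f q))) , inj₂ (refl , n<1+n _) , inj₂ (e , h<N))
              (λ _ → Gap-fibres {X} l))

noMin-· : ∀ {X Y} → NoMin Y → NoMin (X · Y)
noMin-· noMin (x , y) = let y' , l = noMin y in (x , y') , inj₁ l

noMax-ω· : ∀ {X} → NoMin (op (ω · X))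
noMax-ω· (n , x) = (suc n , x) , inj₂ (refl , n<1+n n)

module _ {X Y : LO} (sX : Strict X) (sY : Strict Y) (noMinX : NoMin X) (noMinY : NoMin Y)
         (a₀ : Carrier X) (b₀ : Carrier Y) where

  -- Duplicator copies the ω-coordinate until two moves are left.
  ω·-wins : ∀ k qs → Wins X Y k (map proj₂ qs) → Wins (ω · X) (ω · Y) (2 + k) (map level qs)
  ω·-wins (suc k) qs (f , g) =
      (λ (n , a) → let b , w = f a in (n , b) , ω·-wins k ((n , a , b) ∷ qs) w)
    , (λ (n , b) → let a , w = g b in (n , a) , ω·-wins k ((n , a , b) ∷ qs) w)
  -- The game on `X` and `Y` is over. `answer₂` meets the first of the two extra moves and leaves a
  -- position that `wins₁` can finish.
  ω·-wins zero qs iso =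
      (λ a → let b , new = answer₂ sX sY noMinY b₀ ag a in b , next new)
    , (λ b → let a , new = answer₂ sY sX noMinX a₀ {f = Product.map₂ swap} ag' b in
         a , next (λ q → Agree-swap (λ {p} {q} → SameGap-swap (ω · Y) (ω · X) {p} {q}) (new q)))
    where
    ag : Agreeing X Y (Any-interval X Y) proj₂ qs
    ag p q = iso⇒Agree sX (iso (∈-map⁺ proj₂ p) (∈-map⁺ proj₂ q))
                          (proj₂ (iso (∈-map⁺ proj₂ q) (∈-map⁺ proj₂ p)))
    ag' : Agreeing Y X (Any-interval Y X) (swap ∘ proj₂) qs
    ag' p q = Agree-swap _ (ag p q)
    next : ∀ {r} → (∀ {q} → q ∈ qs → Agree (ω · X) (ω · Y) (SameGap (ω · X) (ω · Y)) r (level q)) →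
           Wins (ω · X) (ω · Y) 1 (r ∷ map level qs)
    next new = wins₁ (·-strict <-isStrictTotalOrder sX) (·-strict <-isStrictTotalOrder sY)
      (noMin-· {ω} {X} noMinX) noMax-ω· (noMin-· {ω} {Y} noMinY) noMax-ω·
      (0 , a₀) (0 , b₀) (Agreeing-∷
        (Agreeing-map (λ p q → Agree-ω sX sY (ag p q)))
        (∈-map-elim (Agree (ω · X) (ω · Y) (SameGap (ω · X) (ω · Y)) _) new))

bottom : ∀ {A B : Set} → A × B → (ℕ × A) × (ℕ × B)
bottom p = level (0 , p)

-- Nothing in `ω` is below 0, so a point below `(0 , x)` is in an earlier fibre, which has no last
-- element.
Gap-limit : ∀ {X x} (a : Carrier (ω · X)) → _≺_ (ω · X) a (0 , x) → Gap (ω · X) a (0 , x)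
Gap-limit (n , x') (inj₁ l) = (suc n , x') , inj₂ (refl , n<1+n n) , inj₁ l

no-Gap-suc : ∀ {X x n} → Strict X → ¬ Gap (ω · X) (n , x) (suc n , x)
no-Gap-suc sX (_ , inj₁ l , inj₁ m) = IsStrictTotalOrder.asym sX l m
no-Gap-suc sX (_ , inj₁ l , inj₂ (refl , _)) = IsStrictTotalOrder.irrefl sX refl l
no-Gap-suc sX (_ , inj₂ (refl , _) , inj₁ m) = IsStrictTotalOrder.irrefl sX refl m
no-Gap-suc sX (_ , inj₂ (_ , l) , inj₂ (_ , s≤s m)) = <-irrefl refl (≤-trans l m)

-- Spoiler plays only limits (0 , x); an answer that is a successor loses in
-- the two extra moves.
ω·-wins⁻ : ∀ {X Y} → Strict X → Strict Y → ∀ k ps →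
           Wins (ω · X) (ω · Y) (2 + k) (map bottom ps) → Wins X Y k ps
ω·-wins⁻ {X} {Y} sX sY zero [] w ()
ω·-wins⁻ {X} {Y} sX sY zero ps@((a , _) ∷ _) w p q =
    mk⇔ (cong proj₂ ∘ E.to (proj₁ i) ∘ cong (0 ,_)) (cong proj₂ ∘ E.from (proj₁ i) ∘ cong (0 ,_))
  , mk⇔ (base {Y} ∘ E.to (proj₂ i) ∘ inj₁) (base {X} ∘ E.from (proj₂ i) ∘ inj₁)
  where
  module E = Equivalence
  -- The two extra moves are spent on the dummy point `(0 , a)`, available since the position is
  -- nonempty.
  i = Wins⇒PartialIso {ω · X} {ω · Y} (0 , a) 2 w (∈-map⁺ bottom p) (∈-map⁺ bottom q)
  base : ∀ {Z : LO} {x x'} → _≺_ (ω · Z) (0 , x) (0 , x') → _≺_ Z x x'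
  base (inj₁ l) = l
ω·-wins⁻ {X} {Y} sX sY (suc k) ps (f , g) = forth , back
  where
  forth : ∀ a → ∃ λ b → Wins X Y k ((a , b) ∷ ps)
  forth a with f (0 , a)
  ... | (0 , b) , w = b , ω·-wins⁻ sX sY k ((a , b) ∷ ps) w
  ... | (suc n , b) , w = ⊥-elim
    (no-cover {ω · X} {ω · Y} k Gap-limit (inj₂ (refl , n<1+n n)) (no-Gap-suc sY) w)
  back : ∀ b → ∃ λ a → Wins X Y k ((a , b) ∷ ps)
  back b with g (0 , b)
  ... | (0 , a) , w = a , ω·-wins⁻ sX sY k ((a , b) ∷ ps) w
  ... | (suc n , a) , w = ⊥-elim
    (no-cover {ω · Y} {ω · X} k Gap-limit (inj₂ (refl , n<1+n n)) (no-Gap-suc sX) (Wins-swap (2 + k) w))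

-- NoMin (toward c X) is what multiplication by ωor* c needs to gain two moves:
-- no least element for ω, no greatest element for ω*.
toward : Bool → LO → LO
toward true X = X
toward false X = op X

ωor*·-≡ : ∀ c {X Y k} → Strict X → Strict Y → NoMin (toward c X) → NoMin (toward c Y) →
  Carrier X → Carrier Y → X ≡[ k ] Y → (ωor* c · X) ≡[ 2 + k ] (ωor* c · Y)
ωor*·-≡ true {k = k} sX sY mX mY a b w = ω·-wins sX sY mX mY a b k [] w
ωor*·-≡ false {X} {Y} {k} sX sY mX mY a b w =
  Wins-≅ {op (ω · op X)} {_} {op (ω · op Y)} op-ω·op≅ω*· op-ω·op≅ω*· (2 + k)
    (Wins-op (2 + k) (ω·-wins (op-strict sX) (op-strict sY) mX mY a b k [] (Wins-op k w)))

ωor*·-≡⁻ : ∀ c {X Y k} → Strict X → Strict Y →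
  (ωor* c · X) ≡[ 2 + k ] (ωor* c · Y) → X ≡[ k ] Y
ωor*·-≡⁻ true {k = k} sX sY w = ω·-wins⁻ sX sY k [] w
ωor*·-≡⁻ false {X} {Y} {k} sX sY w =
  Wins-op k (ω·-wins⁻ (op-strict sX) (op-strict sY) k []
    (Wins-op (2 + k) (Wins-≅ {_} {op (ω · op X)} {_} {op (ω · op Y)}
      (≅-sym op-ω·op≅ω*·) (≅-sym op-ω·op≅ω*·) (2 + k) w)))

-- Words in ω and ω*

-- The head is the least significant factor. Bracketing to the right, unlike `prod`, exposes it for
-- stripping.
W : List Bool → LO
W [] = 𝟙
W (c ∷ w) = ωor* c · W w

W-strict : ∀ w → Strict (W w)
W-strict [] = 𝟙-strict
W-strict (c ∷ w) = ·-strict (ωor*-strict c) (W-strict w)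

W-point : ∀ w → Carrier (W w)
W-point [] = tt
W-point (true ∷ w) = 0 , W-point w
W-point (false ∷ w) = 0 , W-point w

W-++ : ∀ v w → W (v ++ w) ≅ W v · W w
W-++ [] w = ≅-sym 𝟙·X≅X
W-++ (c ∷ v) w = ≅-trans (·-cong ≅-refl (W-++ v w)) (≅-sym ·-assoc)

replicate-∷ʳ : ∀ n (c : Bool) → replicate n c ++ c ∷ [] ≡ c ∷ replicate n c
replicate-∷ʳ zero c = refl
replicate-∷ʳ (suc n) c = cong (c ∷_) (replicate-∷ʳ n c)

W-replicate : ∀ c n → (ωor* c ^ n) ≅ W (replicate n c)
W-replicate c zero = ≅-refl
W-replicate c (suc n) = subst (λ w → (ωor* c ^ suc n) ≅ W w) (replicate-∷ʳ n c)
  (≅-trans (·-cong (W-replicate c n) (≅-sym X·𝟙≅X)) (≅-sym (W-++ (replicate n c) (c ∷ []))))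

blocks : ℕ → (ℕ → ℕ) → (ℕ → Bool) → List Bool
blocks zero f c = []
blocks (suc k) f c = blocks k f c ++ replicate (f k) (c k)

W-blocks : ∀ k f c → prod k (λ i → ωor* (c i) ^ f i) ≅ W (blocks k f c)
W-blocks zero f c = ≅-refl
W-blocks (suc k) f c =
  ≅-trans (·-cong (W-blocks k f c) (W-replicate (c k) (f k))) (≅-sym (W-++ (blocks k f c) _))

-- A single factor without the endpoint in question removes that endpoint from the whole product:
-- move its coordinate and leave the others alone.
W-noMin : ∀ c {w} → not c ∈ w → NoMin (toward c (W w))
W-noMin true (here refl) (n , x) = (suc n , x) , inj₂ (refl , n<1+n n)
W-noMin true (there p) (n , x) = let x' , l = W-noMin true p x in (n , x') , inj₁ l
W-noMin false (here refl) (n , x) = (suc n , x) , inj₂ (refl , n<1+n n)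
W-noMin false (there p) (n , x) = let x' , l = W-noMin false p x in (n , x') , inj₁ l

-- Separating two words once the common prefix is gone

replicate-hasMin : ∀ c k → HasMin (toward c (W (replicate k c)))
replicate-hasMin true zero = tt , λ _ ()
replicate-hasMin false zero = tt , λ _ ()
replicate-hasMin true (suc k) = let x , min = replicate-hasMin true k in
  (0 , x) , λ { (_ , x') (inj₁ l) → min x' l ; _ (inj₂ (_ , ())) }
replicate-hasMin false (suc k) = let x , min = replicate-hasMin false k in
  (0 , x) , λ { (_ , x') (inj₁ l) → min x' l ; _ (inj₂ (_ , ())) }

-- One pair is always a partial isomorphism. With two moves Spoiler exploits the least element (for
-- `ω`) or greatest element (for `ω*`) of the power, which the letter `e` excludes in `W b`.
l-replicate : ∀ k {d e b} → e ≡ not d → e ∈ b → IsL (W (replicate k d)) (W b) 1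
l-replicate k {d} {_} {b} refl e∈b =
    s≤s z≤n
  , ((λ x → W-point b , any-pair) , (λ y → W-point (replicate k d) , any-pair))
  , separate d (replicate-hasMin d k) (W-noMin d e∈b)
  where
  any-pair : ∀ {p} → PartialIso (W (replicate k d)) (W b) (p ∷ [])
  any-pair = Agreeing⇒PartialIso {S = Any-interval (W (replicate k d)) (W b)} (W-strict (replicate k d)) (W-strict b)
    (Agreeing-∷ (λ ()) λ ())
  separate : ∀ d {X Y} → HasMin (toward d X) → NoMin (toward d Y) → ¬ (X ≡[ 2 ] Y)
  separate true h n = ≢₂-HasMin-NoMin h n
  separate false h n = ≢₂-HasMin-NoMin h n ∘ Wins-op 2

-- Spoiler opens with a limit point; every possible answer `(n , y)` covers `(suc n , y)`, which
-- loses in the two moves left.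
≢₃-ω-ω* : ∀ {X Y} → Carrier X → Strict Y → ¬ ((ω · X) ≡[ 3 ] (ω* · Y))
≢₃-ω-ω* {X} {Y} x sY (f , _) with f (0 , x)
... | (n , y) , w = no-cover {ω · X} {ω* · Y} 0 Gap-limit (inj₂ (refl , n<1+n n))
  (λ (z , l , m) → no-Gap-suc (op-strict sY) (z , cancel (op-ω·op≅ω*· {Y}) m , cancel (op-ω·op≅ω*· {Y}) l)) w

-- Each word contains both letters, so both orders are endless and agree for two moves. Immediate
-- predecessors tell them apart in three.
l-opposite : ∀ c {e a b} → e ≡ not c → e ∈ a → c ∈ b → IsL (W (c ∷ a)) (W (e ∷ b)) 2
l-opposite false refl e∈a c∈b = IsL-sym (l-opposite true refl c∈b e∈a)
l-opposite true {_} {a} {b} refl e∈a c∈b =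
    s≤s z≤n
  , ≡₂-endless (W-strict (true ∷ a)) (W-strict (false ∷ b))
      (W-noMin true {true ∷ a} (there e∈a)) (W-noMin false {true ∷ a} (here refl))
      (W-noMin true {false ∷ b} (here refl)) (W-noMin false {false ∷ b} (there c∈b))
      (W-point (true ∷ a)) (W-point (false ∷ b))
  , ≢₃-ω-ω* (W-point a) (W-strict b)

-- Lets the letters of p be put in front of a one at a time: no order to be
-- multiplied by a letter has the endpoint excluded in ωor*·-≡.
Turning : List Bool → List Bool → Set
Turning [] a = ⊤
Turning (c ∷ p) a = not c ∈ p ++ a × Turning p a

prepend-≡ : ∀ p {a b k} → Turning p a → Turning p b →
  W a ≡[ k ] W b → W (p ++ a) ≡[ length p * 2 + k ] W (p ++ b)
prepend-≡ [] _ _ w = w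
prepend-≡ (c ∷ p) {a} {b} (ca , ta) (cb , tb) w =
  ωor*·-≡ c {k = length p * 2 + _} (W-strict (p ++ a)) (W-strict (p ++ b)) (W-noMin c ca) (W-noMin c cb)
    (W-point (p ++ a)) (W-point (p ++ b)) (prepend-≡ p ta tb w)

prepend-≡⁻ : ∀ p {a b k} → W (p ++ a) ≡[ length p * 2 + k ] W (p ++ b) → W a ≡[ k ] W b
prepend-≡⁻ [] w = w
prepend-≡⁻ (c ∷ p) {a} {b} w =
  prepend-≡⁻ p (ωor*·-≡⁻ c {k = length p * 2 + _} (W-strict (p ++ a)) (W-strict (p ++ b)) w)

l-prepend : ∀ p {a b n} → Turning p a → Turning p b →
  IsL (W a) (W b) n → IsL (W (p ++ a)) (W (p ++ b)) (length p * 2 + n)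
l-prepend p {a} {b} {n} ta tb (1≤n , e , ¬e) =
    ≤-trans 1≤n (m≤n+m n _)
  , prepend-≡ p ta tb e
  , λ w → ¬e (prepend-≡⁻ p (subst (λ k → W (p ++ a) ≡[ k ] W (p ++ b)) (sym (+-suc (length p * 2) n)) w))

Turning-++ : ∀ p {q a} → Turning p (q ++ a) → Turning q a → Turning (p ++ q) a
Turning-++ [] _ tq = tq
Turning-++ (c ∷ p) {q} {a} (cp , tp) tq =
  subst (not c ∈_) (sym (++-assoc p q a)) cp , Turning-++ p tp tq

Turning-replicate : ∀ k {c a} → not c ∈ a → Turning (replicate k c) a
Turning-replicate zero _ = tt
Turning-replicate (suc k) c∈a = ∈-++⁺ʳ (replicate k _) c∈a , Turning-replicate k c∈a

-- Words built from alternating blocks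

∈-replicate : ∀ {k} {c : Bool} → 1 ≤ k → c ∈ replicate k c
∈-replicate (s≤s _) = here refl

-- Every letter finds its opposite in the next block, which is nonempty; for the last block `a`
-- supplies it.
Turning-blocks : ∀ k {f c a} → (∀ i → i < k → 1 ≤ f i) → (∀ i → i < k → c (suc i) ≡ not (c i)) →
  c k ∈ a → Turning (blocks k f c) a
Turning-blocks zero _ _ _ = tt
Turning-blocks (suc k) {c = c} {a} pos alt c∈a = Turning-++ (blocks k _ c)
  (Turning-blocks k (λ i l → pos i (m<n⇒m<1+n l)) (λ i l → alt i (m<n⇒m<1+n l))
    (∈-++⁺ˡ (∈-replicate (pos k ≤-refl))))
  (Turning-replicate _ (subst (_∈ a) (alt k ≤-refl) c∈a))

-- Built from the front, whereas `blocks` grows at the back, so that what follows a common prefix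
-- has its first letter exposed.
segment : ℕ → ℕ → (ℕ → ℕ) → (ℕ → Bool) → List Bool
segment i zero f c = []
segment i (suc r) f c = replicate (f i) (c i) ++ segment (suc i) r f c

blocks-split : ∀ k r f c → blocks (r + k) f c ≡ blocks k f c ++ segment k r f c
blocks-split k zero f c = sym (++-identityʳ _)
blocks-split k (suc r) f c = trans (cong (λ j → blocks j f c) (sym (+-suc r k)))
  (trans (blocks-split (suc k) r f c) (++-assoc (blocks k f c) _ _))

blocks-cong : ∀ k {f g} c → (∀ i → i < k → f i ≡ g i) → blocks k f c ≡ blocks k g c
blocks-cong zero c _ = refl
blocks-cong (suc k) c f≡g = cong₂ _++_ (blocks-cong k c (λ i l → f≡g i (m<n⇒m<1+n l)))
  (cong (λ j → replicate j (c k)) (f≡g k ≤-refl))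

sumTo-cong : ∀ k {f g} → (∀ i → i < k → f i ≡ g i) → sumTo k f ≡ sumTo k g
sumTo-cong zero _ = refl
sumTo-cong (suc k) f≡g = cong₂ _+_ (sumTo-cong k (λ i l → f≡g i (m<n⇒m<1+n l))) (f≡g k ≤-refl)

length-blocks : ∀ k f c → length (blocks k f c) ≡ sumTo k f
length-blocks zero f c = refl
length-blocks (suc k) f c = trans (length-++ (blocks k f c))
  (cong₂ _+_ (length-blocks k f c) (length-replicate (f k)))

replicate-+ : ∀ j k (c : Bool) → replicate (j + k) c ≡ replicate j c ++ replicate k c
replicate-+ zero k c = refl
replicate-+ (suc j) k c = cong (c ∷_) (replicate-+ j k c)

IsL-words : ∀ {v v' w w' k k'} → v' ≡ v → w' ≡ w → k ≡ k' → IsL (W v) (W w) k → IsL (W v') (W w') k'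
IsL-words refl refl refl l = l

length-blocks-*2 : ∀ k f c j → length (blocks k f c) * 2 + j ≡ 2 * sumTo k f + j
length-blocks-*2 k f c j =
  cong (_+ j) (trans (cong (_* 2) (length-blocks k f c)) (*-comm (sumTo k f) 2))

-- The prefix belongs to the word with the smaller exponent at `u`. Past it the larger word still
-- has `suc e = f u - g u` letters of block `u`.
larger-split : ∀ c u r {f g} → (∀ i → i < u → f i ≡ g i) → g u < f u → ∃ λ e →
  blocks (2 + r + u) f c ≡ blocks (suc u) g c ++
    c u ∷ (replicate e (c u) ++ replicate (f (suc u)) (c (suc u)) ++ segment (2 + u) r f c)
larger-split c u r {f} {g} f≡g g<f with m≤n⇒∃[o]m+o≡n g<f
... | e , g+e≡f = e , trans (blocks-split u (2 + r) f c)
    (trans (cong₂ (λ p q → p ++ q ++ rest) (blocks-cong u c f≡g)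
             (trans (cong (λ j → replicate j (c u)) (trans (sym g+e≡f) (sym (+-suc (g u) e))))
                    (replicate-+ (g u) (suc e) (c u))))
    (trans (cong (blocks u g c ++_) (++-assoc (replicate (g u) (c u)) _ rest))
           (sym (++-assoc (blocks u g c) _ _))))
  where
  rest : List Bool
  rest = replicate (f (suc u)) (c (suc u)) ++ segment (2 + u) r f c

not-swap : ∀ {a b} → a ≡ not b → b ≡ not a
not-swap refl = sym (not-involutive _)

-- Strip the first `v` blocks. A power of `c v` remains on the left, while block `suc v` on the
-- right has the opposite letter, so `l-replicate` adds one.
l-last-block : ∀ c v r {m n} → (∀ i → i < suc v → c (suc i) ≡ not (c i)) →
  (∀ i → i < suc v → 1 ≤ m i) → 1 ≤ n v → 1 ≤ n (suc v) → (∀ i → i < v → m i ≡ n i) →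
  IsL (W (blocks (suc v) m c)) (W (blocks (2 + r + v) n c)) (2 * sumTo v m + 1)
l-last-block c v r {m} {n} alt pos nv nv' m≡n = IsL-words {blocks (suc v) m c} refl
  (trans (blocks-split v (2 + r) n c) (cong (_++ segment v (2 + r) n c) (sym (blocks-cong v c m≡n))))
  (length-blocks-*2 v m c 1)
  (l-prepend (blocks v m c) (turn (∈-replicate (pos v ≤-refl))) (turn (∈-++⁺ˡ (∈-replicate nv)))
    (l-replicate (m v) (alt v ≤-refl) (∈-++⁺ʳ (replicate (n v) (c v)) (∈-++⁺ˡ (∈-replicate nv')))))
  where
  turn : ∀ {a} → c v ∈ a → Turning (blocks v m c) a
  turn = Turning-blocks v (λ i l → pos i (m<n⇒m<1+n l)) (λ i l → alt i (m<n⇒m<1+n l))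

-- All but the last block of the shorter word can be stripped. Its last block is a power of
-- `c (suc u)`, and the other remainder starts with the opposite letter `c u`.
l-penultimate-block : ∀ c u r {m n} → (∀ i → i < suc u → c (suc i) ≡ not (c i)) →
  (∀ i → i < 2 + u → 1 ≤ m i) → 1 ≤ n (suc u) → (∀ i → i < u → n i ≡ m i) → m u < n u →
  IsL (W (blocks (2 + u) m c)) (W (blocks (2 + r + u) n c)) (2 * sumTo (suc u) m + 1)
l-penultimate-block c u r {m} {n} alt pos nu' n≡m m<n with larger-split c u r n≡m m<n
... | e , split = IsL-words {blocks (2 + u) m c} refl split (length-blocks-*2 (suc u) m c 1)
  (l-prepend (blocks (suc u) m c) (turn (∈-replicate (pos (suc u) ≤-refl)))
    (turn (there (∈-++⁺ʳ (replicate e (c u)) (∈-++⁺ˡ (∈-replicate nu')))))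
    (l-replicate (m (suc u)) {b = c u ∷ (replicate e (c u) ++ replicate (n (suc u)) (c (suc u)) ++ segment (2 + u) r n c)}
      (not-swap (alt u ≤-refl)) (here refl)))
  where
  turn : ∀ {a} → c (suc u) ∈ a → Turning (blocks (suc u) m c) a
  turn = Turning-blocks (suc u) (λ i l → pos i (m<n⇒m<1+n l)) alt

-- Past the common prefix `f` continues with `c u` and `g` with `c (suc u)`. Both letters occur in
-- both remainders, so `l-opposite` adds two.
l-inner-block : ∀ c u r r' {f g} → (∀ i → i < 2 + u → c (suc i) ≡ not (c i)) →
  1 ≤ f (suc u) → (∀ i → i < 3 + u → 1 ≤ g i) → (∀ i → i < u → f i ≡ g i) → g u < f u →
  IsL (W (blocks (2 + r + u) f c)) (W (blocks (3 + r' + u) g c)) (2 * sumTo (suc u) g + 2)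
l-inner-block c u r r' {f} {g} alt fu' pos f≡g g<f with larger-split c u r f≡g g<f
... | e , split = IsL-words split split' (length-blocks-*2 (suc u) g c 2)
  (l-prepend (blocks (suc u) g c) (turn (there c'∈)) (turn (here refl))
    (l-opposite (c u) (alt u (m<n⇒m<1+n (n<1+n u))) c'∈
      -- The letter `c u` returns in block `2 + u` of `g`, hence the bound of three blocks past `u`.
      -- The `∸ 1` accounts for the head already split off.
      (∈-++⁺ʳ (replicate (g (suc u) ∸ 1) (c (suc u)))
        (∈-++⁺ˡ (subst (_∈ replicate (g (2 + u)) (c (2 + u))) c''≡c (∈-replicate (pos (2 + u) ≤-refl)))))))
  where
  c''≡c : c (2 + u) ≡ c u
  c''≡c = trans (alt (suc u) ≤-refl) (sym (not-swap (alt u (m<n⇒m<1+n (n<1+n u)))))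
  c'∈ : c (suc u) ∈ replicate e (c u) ++ replicate (f (suc u)) (c (suc u)) ++ segment (2 + u) r f c
  c'∈ = ∈-++⁺ʳ (replicate e (c u)) (∈-++⁺ˡ (∈-replicate fu'))
  turn : ∀ {a} → c (suc u) ∈ a → Turning (blocks (suc u) g c) a
  turn = Turning-blocks (suc u) (λ i l → pos i (m<n⇒m<1+n (m<n⇒m<1+n l))) (λ i l → alt i (m<n⇒m<1+n l))
  replicate-pos : ∀ {k d w} → 1 ≤ k → replicate k d ++ w ≡ d ∷ replicate (k ∸ 1) d ++ w
  replicate-pos (s≤s _) = refl
  split' : blocks (3 + r' + u) g c ≡ blocks (suc u) g c ++
    c (suc u) ∷ replicate (g (suc u) ∸ 1) (c (suc u)) ++ segment (2 + u) (suc r') g c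
  split' = trans (cong (λ k → blocks (2 + k) g c) (sym (+-suc r' u)))
    (trans (blocks-split (suc u) (2 + r') g c)
      (cong (blocks (suc u) g c ++_) (replicate-pos (pos (suc u) (m<n⇒m<1+n (n<1+n _))))))

-- The shape `j + r + k` is that of the block counts above, so matching on `refl` makes their lemmas
-- applicable.
gap-below : ∀ j k {t} → j + k ≤ t → ∃ λ r → t ≡ j + r + k
gap-below j k {t} l = t ∸ (j + k) , trans (sym (m∸n+n≡m l))
  (trans (sym (+-assoc (t ∸ (j + k)) j k)) (cong (_+ k) (+-comm (t ∸ (j + k)) j)))

theorem3p5 : (s t : ℕ) → 1 ≤ s → s < t →
    (c : ℕ → Bool) → (∀ i → suc i < t → c (suc i) ≢ c i) →
    (m n : ℕ → ℕ) → (∀ i → i < s → 1 ≤ m i) → (∀ j → j < t → 1 ≤ n j) →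
    (u : ℕ) → u ≤ s → (∀ i → i < u → m i ≡ n i) → (u < s → m u ≢ n u) →
    let A = prod s (λ i → ωor* (c i) ^ m i)
        B = prod t (λ j → ωor* (c j) ^ n j)
    in ((u ≡ s ⊎ suc u ≡ s) → IsL A B (2 * sumTo (s ∸ 1) m + 1))
     × (u + 2 ≡ s → m u < n u → IsL A B (2 * (sumTo u m + m u) + 1))
     × (u + 2 ≡ s → n u < m u → IsL A B (2 * (sumTo u m + n u) + 2))
     × (u + 2 < s → IsL A B (2 * (sumTo u m + (m u ⊓ n u)) + 2))
theorem3p5 s t 1≤s s<t c alternate m n 1≤m 1≤n u u≤s m≡n mu≢nu =
    (λ u≡ → from-words (last 1≤s s<t 1≤m (agree u≡)))
  , (λ u+2≡s m<n → from-words (penultimate (trans (sym u+2≡s) (+-comm u 2)) m<n))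
  , (λ u+2≡s n<m → from-words (inner-n (≤-reflexive (trans (+-comm 2 u) u+2≡s)) n<m))
  , (λ u+2<s → from-words (inner (subst (_< s) (+-comm u 2) u+2<s)))
  where
  from-words : ∀ {l} → IsL (W (blocks s m c)) (W (blocks t n c)) l →
    IsL (prod s (λ i → ωor* (c i) ^ m i)) (prod t (λ j → ωor* (c j) ^ n j)) l
  from-words = IsL-≅ (≅-sym (W-blocks s m c)) (≅-sym (W-blocks t n c))
  alt : ∀ i → suc i < t → c (suc i) ≡ not (c i)
  alt i l = ¬-not (alternate i l)
  agree : u ≡ s ⊎ suc u ≡ s → ∀ i → i < s ∸ 1 → m i ≡ n i
  agree (inj₁ refl) i l = m≡n i (<-≤-trans l (m∸n≤m u 1))
  agree (inj₂ refl) = m≡n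
  last : ∀ {s} → 1 ≤ s → s < t → (∀ i → i < s → 1 ≤ m i) → (∀ i → i < s ∸ 1 → m i ≡ n i) →
    IsL (W (blocks s m c)) (W (blocks t n c)) (2 * sumTo (s ∸ 1) m + 1)
  last {suc v} _ s<t 1≤m m≡n with gap-below 2 v s<t
  ... | r , refl = l-last-block c v r (λ i l → alt i (<-≤-trans (s≤s l) s<t)) 1≤m
    (1≤n v (<-trans (n<1+n v) s<t)) (1≤n (suc v) s<t) m≡n
  penultimate : s ≡ 2 + u → m u < n u →
    IsL (W (blocks s m c)) (W (blocks t n c)) (2 * sumTo (suc u) m + 1)
  penultimate refl m<n with gap-below 2 u (<⇒≤ s<t)
  ... | r , refl = l-penultimate-block c u r (λ i l → alt i (<-trans (s≤s l) s<t)) 1≤m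
    (1≤n (suc u) (<-trans (n<1+n _) s<t)) (λ i l → sym (m≡n i l)) m<n
  -- Serves both (ii) and (iii): the smaller exponent is in the longer word, whose block `2 + u`
  -- exists because `s < t`.
  inner-n : 2 + u ≤ s → n u < m u →
    IsL (W (blocks s m c)) (W (blocks t n c)) (2 * (sumTo u m + n u) + 2)
  inner-n 2+u≤s n<m with gap-below 2 u 2+u≤s | gap-below 3 u (≤-<-trans 2+u≤s s<t)
  ... | r , refl | r' , refl = subst (λ k → IsL (W (blocks s m c)) (W (blocks t n c)) (2 * (k + n u) + 2))
    (sym (sumTo-cong u m≡n))
    (l-inner-block c u r r' (λ i l → alt i (≤-<-trans (≤-trans l 2+u≤s) s<t)) (1≤m (suc u) 2+u≤s)
      (λ i l → 1≤n i (≤-trans l (≤-<-trans 2+u≤s s<t))) m≡n n<m)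
  inner : 2 + u < s → IsL (W (blocks s m c)) (W (blocks t n c)) (2 * (sumTo u m + (m u ⊓ n u)) + 2)
  inner 2+u<s with <-cmp (m u) (n u)
  ... | tri≈ _ e _ = ⊥-elim (mu≢nu (<-trans (n<1+n u) (<-trans (n<1+n _) 2+u<s)) e)
  ... | tri> _ _ n<m rewrite m≥n⇒m⊓n≡n (<⇒≤ n<m) = inner-n (<⇒≤ 2+u<s) n<m
  -- The roles are exchanged: the shorter word now has the smaller exponent and must itself have a
  -- block `2 + u`, which is what `2 + u < s` grants.
  ... | tri< m<n _ _ rewrite m≤n⇒m⊓n≡m (<⇒≤ m<n)
    with gap-below 3 u 2+u<s | gap-below 2 u (<⇒≤ (<-trans 2+u<s s<t))
  ...   | r , refl | r' , refl = IsL-sym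
    (l-inner-block c u r' r (λ i l → alt i (≤-<-trans l (<-trans 2+u<s s<t)))
      (1≤n (suc u) (<-trans (n<1+n _) (<-trans 2+u<s s<t)))
      (λ i l → 1≤m i (≤-trans l 2+u<s)) (λ i l → sym (m≡n i l)) m<n)
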